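{- Let $E$ be an infinite set. Then the poset $\mathcal{P}(E)/\mathrm{Fin}$ does not have the chain-gap property.
   Context: $\mathcal{P}(E)$ is the power set of $E$, $\mathrm{Fin}$ is the ideal of finite subsets of $E$, and $\mathcal{P}(E)/\mathrm{Fin}$ is the quotient Boolean algebra with its usual order: the class of $X$ is below the class of $Y$ iff $X\setminus Y$ is finite. For a poset $P$ and $C\subseteq P$, let $C^*=\{x\in P: y\le x \text{ for all } y\in C\}$ and $C_*=\{x\in P: x\le y\text{ for all }y\in C\}$ (so $\emptyset^*=\emptyset_*=P$). A pair $(A,B)$ of subsets of $P$ is a pregap if $A\subseteq B_*$ (i.e. $a\le b$ for all $a\in A$, $b\in B$). A pregap is separable if $A^*\cap B_*\neq\emptyset$; otherwise it is a gap of $P$. An order-preserving map $g:P\to Q$ between posets preserves a gap $(A,B)$ of $P$ if $(g[A],g[B])$ is a gap of $Q$. A poset $Q$ preserves the gap $(A,B)$ of $P$ if some order-preserving map $g:P\to Q$ preserves it. The poset $P$ has the chain-gap property if each gap of $P$ is preserved by some chain (totally ordered set). -}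

module Defs where

open import Level using (Level; _⊔_) renaming (suc to lsuc)
open import Axiom.ExcludedMiddle using (ExcludedMiddle)
open import Data.List.Base using (List; []; _++_; filter)
open import Data.List.Membership.Propositional using () renaming (_∈_ to _∈ₗ_)
open import Data.List.Membership.Propositional.Properties
  using (∈-filter⁺; ∈-filter⁻; ∈-++⁺ˡ; ∈-++⁺ʳ; ∈-++⁻)
open import Data.Product.Base using (Σ; ∃-syntax; _×_; _,_; proj₁; proj₂)
open import Data.Sum.Base using (inj₁; inj₂; [_,_]′; swap)
open import Relation.Binary.Bundles using (Poset; TotalOrder)
open import Relation.Binary.Core using (Rel)
open import Relation.Binary.Morphism.Bundles using (PosetHomomorphism)
open import Relation.Nullary.Decidable.Core using (yes; no)
open import Relation.Nullary.Negation.Core using (¬_; contradiction)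
open import Relation.Unary using (Pred; _∈_; _⊆_; _≐_; _∪_; _∩_; _∖_; U; Satisfiable)

private
  variable
    a b c e ℓ ℓ₁ ℓ₂ c′ ℓ₁′ ℓ₂′ : Level

-- Subsets of (the quotient represented by) P are given by arbitrary
-- predicates, not required to respect _≈_.  Since _≤_ and order-preserving
-- maps respect _≈_, a predicate and its ≈-saturation have the same bounds and
-- their images have the same bounds, so nothing changes for gaps.

module _ (P : Poset c ℓ₁ ℓ₂) where
  open Poset P

  UpperBounds : Pred Carrier a → Pred Carrier (c ⊔ ℓ₂ ⊔ a)
  UpperBounds C x = ∀ y → y ∈ C → y ≤ x

  LowerBounds : Pred Carrier a → Pred Carrier (c ⊔ ℓ₂ ⊔ a)
  LowerBounds C x = ∀ y → y ∈ C → x ≤ y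

  IsPregap : Pred Carrier a → Pred Carrier b → Set (c ⊔ ℓ₂ ⊔ a ⊔ b)
  IsPregap A B = A ⊆ LowerBounds B

  Separable : Pred Carrier a → Pred Carrier b → Set (c ⊔ ℓ₂ ⊔ a ⊔ b)
  Separable A B = Satisfiable (UpperBounds A ∩ LowerBounds B)

  IsGap : Pred Carrier a → Pred Carrier b → Set (c ⊔ ℓ₂ ⊔ a ⊔ b)
  IsGap A B = IsPregap A B × ¬ Separable A B

module _ (P : Poset c ℓ₁ ℓ₂) (Q : Poset c′ ℓ₁′ ℓ₂′) where
  private
    module P = Poset P
    module Q = Poset Q

  image : PosetHomomorphism P Q → Pred P.Carrier a → Pred Q.Carrier (c ⊔ ℓ₁′ ⊔ a)
  image g A y = ∃[ x ] x ∈ A × PosetHomomorphism.⟦_⟧ g x Q.≈ y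

  PreservesGap : Pred P.Carrier a → Pred P.Carrier b →
                 Set (c ⊔ ℓ₁ ⊔ ℓ₂ ⊔ c′ ⊔ ℓ₁′ ⊔ ℓ₂′ ⊔ a ⊔ b)
  PreservesGap A B =
    Σ (PosetHomomorphism P Q) λ g → IsGap Q (image g A) (image g B)

-- The last three levels fix the universe from which the chains are drawn.

ChainGapProperty : Poset c ℓ₁ ℓ₂ → (c′ ℓ₁′ ℓ₂′ : Level) →
                   Set (lsuc (c ⊔ c′ ⊔ ℓ₁′ ⊔ ℓ₂′) ⊔ ℓ₁ ⊔ ℓ₂)
ChainGapProperty {c} P c′ ℓ₁′ ℓ₂′ =
  (A B : Pred (Poset.Carrier P) c) → IsGap P A B →
  Σ (TotalOrder c′ ℓ₁′ ℓ₂′) λ C → PreservesGap P (TotalOrder.poset C) A B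

-- Repetitions in the list are allowed.

Finite : {E : Set e} → Pred E ℓ → Set (e ⊔ ℓ)
Finite {E = E} X = Σ (List E) λ xs → X ≐ (_∈ₗ xs)

Infinite : Set e → Set e
Infinite E = ¬ Finite (U {A = E})

-- Closure of Fin under subsets, and transitivity of inclusion modulo Fin,
-- need excluded middle.

module _ (lem : ∀ ℓ → ExcludedMiddle ℓ) (E : Set e) where

  private
    ⊆-finite : {X Y : Pred E e} → X ⊆ Y → Finite Y → Finite X
    ⊆-finite {X} X⊆Y (ys , Y⊆ys , _) =
      filter X? ys
      , (λ x∈X → ∈-filter⁺ X? (Y⊆ys (X⊆Y x∈X)) x∈X)
      , (λ x∈f → proj₂ (∈-filter⁻ X? {xs = ys} x∈f))
      where X? = λ x → lem e {X x}

    ∪-finite : {X Y : Pred E e} → Finite X → Finite Y → Finite (X ∪ Y)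
    ∪-finite (xs , X⊆xs , xs⊆X) (ys , Y⊆ys , ys⊆Y) =
      xs ++ ys
      , (λ { (inj₁ p) → ∈-++⁺ˡ (X⊆xs p) ; (inj₂ q) → ∈-++⁺ʳ xs (Y⊆ys q) })
      , (λ p → [ (λ q → inj₁ (xs⊆X q)) , (λ q → inj₂ (ys⊆Y q)) ]′ (∈-++⁻ xs p))

    ∖-split : (X Y Z : Pred E e) → X ∖ Z ⊆ (X ∖ Y) ∪ (Y ∖ Z)
    ∖-split X Y Z {x} (x∈X , x∉Z) with lem e {Y x}
    ... | yes x∈Y = inj₂ (x∈Y , x∉Z)
    ... | no  x∉Y = inj₁ (x∈X , x∉Y)

  _△_ : Pred E e → Pred E e → Pred E e
  X △ Y = (X ∖ Y) ∪ (Y ∖ X)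

  _≈*_ : Rel (Pred E e) e
  X ≈* Y = Finite (X △ Y)

  _⊆*_ : Rel (Pred E e) e
  X ⊆* Y = Finite (X ∖ Y)

  private
    ⊆*-reflexive : ∀ {X Y} → X ≈* Y → X ⊆* Y
    ⊆*-reflexive = ⊆-finite inj₁

    ⊆*-trans : ∀ {X Y Z} → X ⊆* Y → Y ⊆* Z → X ⊆* Z
    ⊆*-trans {X} {Y} {Z} p q = ⊆-finite (∖-split X Y Z) (∪-finite p q)

    ≈*-refl : ∀ {X} → X ≈* X
    ≈*-refl = [] , (λ { (inj₁ (p , q)) → contradiction p q
                      ; (inj₂ (p , q)) → contradiction p q }) , λ ()

    ≈*-sym : ∀ {X Y} → X ≈* Y → Y ≈* X
    ≈*-sym = ⊆-finite swap

    ≈*-trans : ∀ {X Y Z} → X ≈* Y → Y ≈* Z → X ≈* Z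
    ≈*-trans {X} {Y} {Z} p q =
      ∪-finite (⊆*-trans {X} {Y} {Z} (⊆*-reflexive p) (⊆*-reflexive q))
               (⊆*-trans {Z} {Y} {X} (⊆*-reflexive (≈*-sym {Y} {Z} q))
                                     (⊆*-reflexive (≈*-sym {X} {Y} p)))

  𝒫/Fin : Poset (lsuc e) e e
  𝒫/Fin = record
    { Carrier        = Pred E e
    ; _≈_            = _≈*_
    ; _≤_            = _⊆*_
    ; isPartialOrder = record
      { isPreorder = record
        { isEquivalence = record
          { refl  = λ {X} → ≈*-refl {X}
          ; sym   = λ {X Y} → ≈*-sym {X} {Y}
          ; trans = λ {X Y Z} → ≈*-trans {X} {Y} {Z}
          }
        ; reflexive = λ {X Y} → ⊆*-reflexive {X} {Y}
        ; trans     = λ {X Y Z} → ⊆*-trans {X} {Y} {Z}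
        }
      ; antisym = λ p q → ∪-finite p q
      }
    }

{-# OPTIONS --safe #-}
module Submission where

-- Index a countable part of E by the tree ω^{<ω}; let C s be the set of children
-- of a node s.  The sets C s lie below the complements of the branches, and this
-- is a gap: a set containing almost all children of every node contains a branch.
--
-- Suppose g maps 𝒫(E)/Fin to a chain without closing the gap.  Put the nodes in
-- a sequence and call s a record if g (C s) exceeds the value at every earlier
-- node.  Records are cofinal, and so is every infinite set of records.  If every
-- branch contains finitely many records, then the union of the C s over all
-- records s is almost disjoint from every branch, and its image closes the gap.
-- Otherwise some branch d is cofinal, and the union of the C s over s in d is
-- almost disjoint from every branch except d; since the complement of d cannot
-- have the least image in B, the image of this union closes the gap again.

open import Level using (Level; 0ℓ) renaming (suc to lsuc)
open import Axiom.ExcludedMiddle using (ExcludedMiddle)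
open import Data.List.Base using (List; []; _∷_; filter; applyUpTo)
open import Data.List.Membership.Propositional using () renaming (_∈_ to _∈ₗ_; _∉_ to _∉ₗ_)
open import Data.List.Membership.Propositional.Properties
  using (finite; ∈-filter⁺; ∈-filter⁻; ∈-applyUpTo⁺)
open import Data.List.Relation.Unary.Any using (here; there)
open import Data.Nat.Base
open import Data.Nat.Induction using (<-wellFounded)
open import Data.Nat.Properties
open import Data.Product.Base using (∃; ∃-syntax; _×_; _,_; proj₁; proj₂)
open import Data.Sum.Base using (inj₁; inj₂; [_,_]′)
open import Function.Base using (_∘_)
open import Function.Bundles using (mk↣)
open import Function.Definitions using (Injective)
open import Induction.WellFounded using (Acc; acc)
open import Relation.Binary.Bundles using (Poset; TotalOrder)
open import Relation.Binary.Definitions using (tri<; tri≈; tri>)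
open import Relation.Binary.Morphism.Bundles using (PosetHomomorphism)
open import Relation.Binary.PropositionalEquality
open import Relation.Nullary.Decidable using (Dec; yes; no; True; toWitness; fromWitness; decidable-stable)
open import Relation.Nullary.Negation using (¬_; contradiction)
open import Relation.Unary using (Pred; _∈_; _∉_; _⊆_; ∁; ｛_｝)
open import Defs

-- Nodes of ω^{<ω} are coded by natural numbers, the root being 0; child s k
-- equals 2^k (2s + 1).

child : ℕ → ℕ → ℕ
child s zero    = suc (2 * s)
child s (suc k) = 2 * child s k

child-injective : ∀ {s t} k l → child s k ≡ child t l → s ≡ t × k ≡ l
child-injective zero zero eq = *-cancelˡ-≡ _ _ 2 (suc-injective eq) , refl
child-injective {s} {t} zero (suc l) eq = contradiction (sym eq) (even≢odd (child t l) s)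
child-injective {s} {t} (suc k) zero eq = contradiction eq (even≢odd (child s k) t)
child-injective (suc k) (suc l) eq with child-injective k l (*-cancelˡ-≡ _ _ 2 eq)
... | refl , refl = refl , refl

s<child : ∀ s k → s < child s k
s<child s zero    = s≤s (m≤n*m s 2)
s<child s (suc k) = <-≤-trans (s<child s k) (m≤n*m _ 2)

node : (ℕ → ℕ) → ℕ → ℕ
node b zero    = 0
node b (suc n) = child (node b n) (b n)

-- Codes grow along a branch, so a bound on codes can be traded for a bound on depth.
n≤node : ∀ b n → n ≤ node b n
n≤node b zero    = z≤n
n≤node b (suc n) = ≤-<-trans (n≤node b n) (s<child _ (b n))

-- A node determines its parent and its last step, hence the whole path from the root.
node-agree : ∀ b d m n → node b m ≡ node d n → m ≡ n × (∀ i → i < m → b i ≡ d i)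
node-agree b d zero zero eq = refl , λ _ ()
node-agree b d zero (suc n) eq = contradiction eq (<⇒≢ (≤-<-trans z≤n (n≤node d (suc n))))
node-agree b d (suc m) zero eq = contradiction (sym eq) (<⇒≢ (≤-<-trans z≤n (n≤node b (suc m))))
node-agree b d (suc m) (suc n) eq
  with eqs , eqk ← child-injective (b m) (d n) eq
  with refl , agree ← node-agree b d m n eqs
  = refl , λ i i<1+m → [ agree i , (λ { refl → eqk }) ]′ (m<1+n⇒m<n∨m≡n i<1+m)

node-cong : ∀ {b d} → (∀ i → b i ≡ d i) → ∀ n → node b n ≡ node d n
node-cong eq zero    = refl
node-cong eq (suc n) = cong₂ child (node-cong eq n) (eq n)

∃-branch : ∀ {ℓ} {R : ℕ → ℕ → Set ℓ} → (∀ s → ∃ (R s)) →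
           ∃[ b ] ∀ n → R (node b n) (b n)
∃-branch {R = R} choose = b , λ n → subst (λ s → R s (b n)) (sym (node-b n)) (proj₂ (choose (v n)))
  -- `b` and its nodes depend on each other; `v` computes the nodes first, and `node-b` identifies
  -- them with those of `b`.
  where
  v : ℕ → ℕ
  v zero    = 0
  v (suc n) = child (v n) (proj₁ (choose (v n)))
  b = λ n → proj₁ (choose (v n))
  node-b : ∀ n → node b n ≡ v n
  node-b zero    = refl
  node-b (suc n) = cong (λ s → child s (b n)) (node-b n)

module _ (lem : ∀ ℓ → ExcludedMiddle ℓ) where

  dne : ∀ {ℓ} {P : Set ℓ} → ¬ ¬ P → P
  dne = decidable-stable (lem _)

  ¬∀⇒∃¬ : ∀ {a ℓ} {A : Set a} {P : A → Set ℓ} → ¬ (∀ x → P x) → ∃[ x ] ¬ P x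
  ¬∀⇒∃¬ ¬∀ = dne λ ¬∃ → ¬∀ λ x → dne λ ¬p → ¬∃ (x , ¬p)

  ⊆-list⇒finite : ∀ {e ℓ} {E : Set e} {X : Pred E ℓ} xs → X ⊆ (_∈ₗ xs) → Finite X
  ⊆-list⇒finite {X = X} xs X⊆xs =
    filter X? xs , (λ x∈X → ∈-filter⁺ X? (X⊆xs x∈X) x∈X) , λ x∈f → proj₂ (∈-filter⁻ X? {xs = xs} x∈f)
    where X? = λ x → lem _ {X x}

  infinite⇒∃-injection : ∀ {e} {E : Set e} → Infinite E → ∃[ f ] Injective {A = ℕ} {B = E} _≡_ _≡_ f
  infinite⇒∃-injection {E = E} infinite = f , f-injective
    where
    fresh : (xs : List E) → ∃[ x ] x ∉ₗ xs
    fresh xs = ¬∀⇒∃¬ λ all∈ → infinite (xs , (λ _ → all∈ _) , λ _ → _)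

    used : ℕ → List E
    used zero    = []
    used (suc n) = proj₁ (fresh (used n)) ∷ used n

    f : ℕ → E
    f n = proj₁ (fresh (used n))

    f∈used : ∀ {m n} → m <′ n → f m ∈ₗ used n
    f∈used <′-base       = here refl
    f∈used (≤′-step m<n) = there (f∈used m<n)

    f-distinct : ∀ {m n} → m < n → f m ≢ f n
    f-distinct {m} {n} m<n eq = proj₂ (fresh (used n)) (subst (_∈ₗ used n) eq (f∈used (<⇒<′ m<n)))

    f-injective : Injective _≡_ _≡_ f
    f-injective {m} {n} eq with <-cmp m n
    ... | tri< m<n _ _ = contradiction eq (f-distinct m<n)
    ... | tri≈ _ m≡n _ = m≡n
    ... | tri> _ _ n<m = contradiction (sym eq) (f-distinct n<m)

  module _ {e} {E : Set e} (ι : ℕ → E) (ι-injective : Injective _≡_ _≡_ ι) where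

    private
      P = 𝒫/Fin lem E
      module P = Poset P

    Children : Pred ℕ 0ℓ → Pred E e
    Children S z = ∃[ s ] s ∈ S × ∃[ k ] z ≡ ι (child s k)

    C : ℕ → Pred E e
    C s = Children ｛ s ｝

    Branch : (ℕ → ℕ) → Pred E e
    Branch b z = ∃[ n ] z ≡ ι (node b n)

    A B : Pred P.Carrier (lsuc e)
    A X = ∃[ s ] X ≡ C s
    B X = ∃[ b ] X ≡ ∁ (Branch b)

    ⊆⇒≤ : ∀ {X Y : Pred E e} → X ⊆ Y → X P.≤ Y
    ⊆⇒≤ X⊆Y = ⊆-list⇒finite [] λ (x∈X , x∉Y) → contradiction (X⊆Y x∈X) x∉Y

    -- A child of a member of `S` that lies on the branch at depth `suc n` has parent `node b n`, so
    -- `n < m`: the nodes of depth at most `m` cover the intersection.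
    Children-≤ : ∀ {S} b m → (∀ n → m ≤ n → node b n ∉ S) → Children S P.≤ ∁ (Branch b)
    Children-≤ {S} b m miss =
      ⊆-list⇒finite (applyUpTo (ι ∘ node b) (suc m)) λ (z∈C , ¬¬z∈b) → bound z∈C (dne ¬¬z∈b)
      where
      bound : ∀ {z} → z ∈ Children S → z ∈ Branch b → z ∈ₗ applyUpTo (ι ∘ node b) (suc m)
      bound z∈C (zero , refl) = ∈-applyUpTo⁺ (ι ∘ node b) z<s
      bound (s , s∈S , k , eq) (suc n , refl) with refl , _ ← child-injective (b n) k (ι-injective eq) =
        ∈-applyUpTo⁺ (ι ∘ node b) (s<s (≰⇒> λ m≤n → miss n m≤n s∈S))

    pregap : ∀ s b → C s P.≤ ∁ (Branch b)
    pregap s b = Children-≤ b (suc s) λ n s<n eq → <⇒≢ (<-≤-trans s<n (n≤node b n)) eq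

    unseparable : ¬ Separable P A B
    unseparable (x , A≤x , x≤B) = finite (mk↣ ιb-injective) (proj₁ fin)
      λ n → proj₁ (proj₂ fin) (b∈x n , λ ∉b → ∉b (suc n , refl))
      where
      child∈x : ∀ s → ∃[ k ] ι (child s k) ∈ x
      -- Otherwise the list `zs` would contain all of the infinitely many children of `s`.
      child∈x s with zs , C∖x⊆zs , _ ← A≤x (C s) (s , refl) = dne λ ¬∃ →
        finite (mk↣ (proj₂ ∘ child-injective _ _ ∘ ι-injective)) zs
          λ k → C∖x⊆zs ((s , refl , k , refl) , λ ∈x → ¬∃ (k , ∈x))

      b = proj₁ (∃-branch child∈x)

      b∈x : ∀ n → ι (node b (suc n)) ∈ x
      b∈x = proj₂ (∃-branch child∈x)

      ιb-injective : Injective _≡_ _≡_ (ι ∘ node b ∘ suc)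
      ιb-injective {m} {n} = suc-injective ∘ proj₁ ∘ node-agree b b (suc m) (suc n) ∘ ι-injective

      fin : Finite _
      fin = x≤B (∁ (Branch b)) (b , refl)

    isGap : IsGap P A B
    isGap = (λ { (s , refl) _ (b , refl) → pregap s b }) , unseparable

    module _ {c ℓ₁ ℓ₂} (Q : TotalOrder c ℓ₁ ℓ₂) (g : PosetHomomorphism P (TotalOrder.poset Q)) where
      private
        module Q = TotalOrder Q
        open PosetHomomorphism g using (⟦_⟧; mono)

      p : ℕ → Q.Carrier
      p s = ⟦ C s ⟧

      q : (ℕ → ℕ) → Q.Carrier
      q b = ⟦ ∁ (Branch b) ⟧

      p≤q : ∀ s b → p s Q.≤ q b
      p≤q s b = mono (pregap s b)

      ImagesSeparable : Set _
      ImagesSeparable = Separable Q.poset (image P Q.poset g A) (image P Q.poset g B)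

      separable : ∀ y → (∀ s → p s Q.≤ y) → (∀ b → y Q.≤ q b) → ImagesSeparable
      separable y p≤y y≤q = y
        , (λ { _ (_ , (s , refl) , eq) → Q.trans (Q.reflexive (Q.Eq.sym eq)) (p≤y s) })
        , (λ { _ (_ , (b , refl) , eq) → Q.trans (y≤q b) (Q.reflexive eq) })

      -- Decided by lem, so that records form a set of level 0 whatever the level of Q.
      Record : Pred ℕ 0ℓ
      Record s = True (lem ℓ₂ {∀ t → t < s → ¬ (p s Q.≤ p t)})

      -- A node that is not a record lies below an earlier one in value, and descent along codes
      -- terminates.
      record-above : ∀ s → ∃[ r ] r ∈ Record × p s Q.≤ p r
      record-above s = go s (<-wellFounded s) Q.refl
        where
        go : ∀ r → Acc _<_ r → p s Q.≤ p r → ∃[ r ] r ∈ Record × p s Q.≤ p r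
        go r (acc rec) s≤r with lem _ {∀ t → t < r → ¬ (p r Q.≤ p t)}
        ... | yes isRec = r , fromWitness isRec , s≤r
        ... | no ¬rec
          with t , ¬t ← ¬∀⇒∃¬ ¬rec
          with t<r , ¬¬r≤t ← ¬∀⇒∃¬ ¬t
          = go t (rec t<r) (Q.trans s≤r (dne ¬¬r≤t))

      p≤Children : ∀ {S} s → s ∈ S → p s Q.≤ ⟦ Children S ⟧
      p≤Children s s∈S = mono (⊆⇒≤ λ { (_ , refl , z) → s , s∈S , z })

      separable-finite : (∀ b → ∃[ m ] ∀ n → m ≤ n → node b n ∉ Record) → ImagesSeparable
      separable-finite miss = separable ⟦ Children Record ⟧
        (λ s → let r , r∈R , s≤r = record-above s in Q.trans s≤r (p≤Children r r∈R))
        (λ b → let m , miss-b = miss b in mono (Children-≤ b m miss-b))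

      separable-infinite : ∀ d → (∀ m → ∃[ n ] m ≤ n × node d n ∈ Record) → ImagesSeparable
      separable-infinite d hit = by-cases (lem _)
        where
        OnD : Pred ℕ 0ℓ
        OnD s = ∃[ n ] s ≡ node d n

        x = ⟦ Children OnD ⟧

        p≤x : ∀ s → p s Q.≤ x
        p≤x s with r , _ , s≤r ← record-above s
              -- A record deeper than `r` also has a code above `r`, so its value cannot lie below
              -- `p r`; totality gives the other order.
              with n , r<n , isRec ← hit (suc r)
              with Q.total (p r) (p (node d n))
        ... | inj₁ r≤n = Q.trans s≤r (Q.trans r≤n (p≤Children _ (n , refl)))
        ... | inj₂ n≤r = contradiction n≤r (toWitness isRec r (<-≤-trans r<n (n≤node d n)))

        -- Beyond a coordinate where `b` and `d` differ, `node-agree` keeps the nodes of `b` off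
        -- `d`.
        x≤q : ∀ {b} → ¬ (∀ i → b i ≡ d i) → x Q.≤ q b
        x≤q {b} b≢d with i , bi≢di ← ¬∀⇒∃¬ b≢d =
          mono (Children-≤ b (suc i) λ { m i<m (n , eq) → bi≢di (proj₂ (node-agree b d m n eq) i i<m) })

        q-cong : ∀ {b} → (∀ i → b i ≡ d i) → q d Q.≤ q b
        q-cong b≡d = mono (⊆⇒≤ λ ∉d (n , eq) → ∉d (n , trans eq (cong ι (node-cong b≡d n))))

        q-least : ¬ (x Q.≤ q d) → ∀ b → q d Q.≤ q b
        q-least x≰qd b with lem _ {∀ i → b i ≡ d i} | Q.total x (q d)
        ... | yes b≡d | _         = q-cong b≡d
        ... | no b≢d  | inj₁ x≤qd = contradiction x≤qd x≰qd
        ... | no b≢d  | inj₂ qd≤x = Q.trans qd≤x (x≤q b≢d)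

        x≤q-all : x Q.≤ q d → ∀ b → x Q.≤ q b
        x≤q-all x≤qd b with lem _ {∀ i → b i ≡ d i}
        ... | yes b≡d = Q.trans x≤qd (q-cong b≡d)
        ... | no b≢d  = x≤q b≢d

        -- `Children OnD` contains every node of `d` except the root, so `Children-≤` does not bound
        -- `x` by `q d`. If that bound fails, totality gives `q d Q.≤ x`, so `q d` is least among
        -- the `q b` and itself separates.
        by-cases : Dec (x Q.≤ q d) → ImagesSeparable
        by-cases (yes x≤qd) = separable x p≤x (x≤q-all x≤qd)
        by-cases (no x≰qd)  = separable (q d) (λ s → p≤q s d) (q-least x≰qd)

      images-separable : ImagesSeparable
      images-separable with lem _ {∀ b → ∃[ m ] ∀ n → m ≤ n → node b n ∉ Record}
      ... | yes miss = separable-finite miss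
      -- A branch with no bound on its records has one beyond every depth `m`.
      ... | no ¬miss with d , ¬m ← ¬∀⇒∃¬ ¬miss = separable-infinite d λ m →
        let n , ¬n = ¬∀⇒∃¬ (λ miss → ¬m (m , miss))
            m≤n , ¬∉ = ¬∀⇒∃¬ ¬n
        in n , m≤n , dne ¬∉

theorem1p1 : (lem : ∀ ℓ → ExcludedMiddle ℓ) → ∀ {e} (E : Set e) → Infinite E → (c ℓ₁ ℓ₂ : Level) → ¬ ChainGapProperty (𝒫/Fin lem E) c ℓ₁ ℓ₂
theorem1p1 lem E infinite c ℓ₁ ℓ₂ chainGap =
  let ι , ι-injective = infinite⇒∃-injection lem infinite
      Q , g , _ , ¬separable = chainGap (A lem ι ι-injective) (B lem ι ι-injective) (isGap lem ι ι-injective)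
  in ¬separable (images-separable lem ι ι-injective Q g)
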